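{- Let $n\ge 2$, let $G$ be a (not necessarily commutative) group of order $4n-1$, written additively, and let $D\subseteq G$ be a Paley-type difference set, i.e. a $(4n-1,2n-1,n-1)$ difference set in $G$. Then $D^2\cup(\overline{D})^{2- }\subseteq G^2$ is a difference set of propriety $3$ with parameters $$\big(4n-1,\ (4n-1)(2n-1),\ (4n-1)(n-1)\big).$$
   Context: A $(v,k,\lambda)$ difference set in a group $G$ of order $v$ is a subset $D\subseteq G$ with $|D|=k$ such that for every $g\in G\setminus\{0\}$ there are exactly $\lambda$ choices of $x,x'\in D$ with $x-x'=g$. Notation: $\overline{D}=G\setminus D$, $D^2=D\times D$, and for $E\subseteq G$, $E^{2- }=(E\times E)\setminus\{(x,x)\mid x\in E\}$. A set $P\subseteq G^2$ with $|P|=K$ is a $(v,K,\Lambda)$ difference set of propriety $3$ if for every $g\in G\setminus\{0\}$: 1. there are exactly $\Lambda$ choices of $(x,y),(x',y')\in P$ with $-x+x'=-y+y'=g$; 2. there are exactly $\Lambda$ choices of $(x,y),(x',y')\in P$ with $x-x'=g$ and $y=y'$; 3. there are exactly $\Lambda$ choices of $(x,y),(x',y')\in P$ with $x=x'$ and $y-y'=g$. -}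

module Defs where

open import Algebra.Bundles using (Group)
open import Data.Fin.Base using (Fin)
open import Data.Nat.Base using (ℕ)
open import Data.Product.Base using (Σ; _×_; _,_; proj₁)
open import Data.Product.Relation.Binary.Pointwise.NonDependent using (_×ₛ_)
open import Function.Bundles using (Inverse)
open import Level using (Level; _⊔_)
open import Relation.Binary.Bundles using (Setoid)
import Relation.Binary.Construct.On as On
open import Relation.Binary.Definitions using (_Respects_)
import Relation.Binary.PropositionalEquality.Properties as ≡
open import Relation.Nullary.Negation.Core using (¬_)
open import Relation.Unary using (Pred; _∈_; _∪_; ∁; _⟨×⟩_; _∖_)

private
  variable
    c ℓ p : Level

HasCardinality : Setoid c ℓ → ℕ → Set (c ⊔ ℓ)
HasCardinality S k = Inverse S (≡.setoid (Fin k))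

-- Elements of the subset are compared by the equality of S alone: proofs of
-- membership are ignored, so they do not contribute to cardinalities.
Subsetoid : (S : Setoid c ℓ) → Pred (Setoid.Carrier S) p → Setoid (c ⊔ p) ℓ
Subsetoid S P = On.setoid {B = Σ (Setoid.Carrier S) P} S proj₁

module _ (G : Group c ℓ) where

  open Group G using (Carrier; _≈_; setoid)
    renaming (_∙_ to infixl 6 _+_; ε to 0#; _⁻¹ to infix 8 -_)

  private
    G² : Setoid c ℓ
    G² = setoid ×ₛ setoid

  -- Subsets are arbitrary predicates respecting ≈.  Decidability of D is not
  -- assumed: it follows from the fields order, respects and size.
  record IsDifferenceSet (v k lam : ℕ) (D : Pred Carrier p)
         : Set (c ⊔ ℓ ⊔ p) where
    field
      order       : HasCardinality setoid v
      respects    : D Respects _≈_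
      size        : HasCardinality (Subsetoid setoid D) k
      differences : ∀ g → ¬ (g ≈ 0#) →
        HasCardinality
          (Subsetoid G² λ (x , x′) → x ∈ D × x′ ∈ D × (x + - x′) ≈ g)
          lam

  record IsDifferenceSetOfPropriety3 (v K Lam : ℕ)
         (P : Pred (Carrier × Carrier) p) : Set (c ⊔ ℓ ⊔ p) where
    field
      order    : HasCardinality setoid v
      respects : P Respects (Setoid._≈_ G²)
      size     : HasCardinality (Subsetoid G² P) K
      differences₁ : ∀ g → ¬ (g ≈ 0#) →
        HasCardinality
          (Subsetoid (G² ×ₛ G²) λ ((x , y) , (x′ , y′)) →
            (x , y) ∈ P × (x′ , y′) ∈ P × (- x + x′) ≈ g × (- y + y′) ≈ g)
          Lam
      differences₂ : ∀ g → ¬ (g ≈ 0#) →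
        HasCardinality
          (Subsetoid (G² ×ₛ G²) λ ((x , y) , (x′ , y′)) →
            (x , y) ∈ P × (x′ , y′) ∈ P × (x + - x′) ≈ g × y ≈ y′)
          Lam
      differences₃ : ∀ g → ¬ (g ≈ 0#) →
        HasCardinality
          (Subsetoid (G² ×ₛ G²) λ ((x , y) , (x′ , y′)) →
            (x , y) ∈ P × (x′ , y′) ∈ P × x ≈ x′ × (y + - y′) ≈ g)
          Lam

  infix 9 _² _²⁻

  _² : Pred Carrier p → Pred (Carrier × Carrier) p
  E ² = E ⟨×⟩ E

  diagonal : Pred Carrier p → Pred (Carrier × Carrier) (ℓ ⊔ p)
  diagonal E (x , y) = x ∈ E × x ≈ y

  _²⁻ : Pred Carrier p → Pred (Carrier × Carrier) (ℓ ⊔ p)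
  E ²⁻ = E ² ∖ diagonal E

  squareUnion : Pred Carrier p → Pred (Carrier × Carrier) (ℓ ⊔ p)
  squareUnion D = D ² ∪ (∁ D) ²⁻

{-# OPTIONS --safe #-}
module Submission where

-- Let a(g) = |D ∩ Dg⁻¹| and b(g) = |D ∩ g⁻¹D|.  The hypothesis gives b(g) = λ
-- for g ≠ ε, but the first propriety condition needs a(g) = λ, which in a
-- noncommutative group is a different statement.  Both Σ a² and Σ b² count the
-- quadruples in D with x⁻¹x′ = y⁻¹y′, equivalently yx⁻¹ = y′x′⁻¹, and Σ ab = Σ b²
-- because b is constant off the identity, while Σ a = Σ b and a(ε) = b(ε).
-- Hence Σ (a − b)² = 0 and a = b.
--
-- The three conditions are then counts with the characteristic function
-- χ(x,y) = d(x)d(y) + (1−d(x))(1−d(y))(1−[x=y]).  For the first, classify x by the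
-- memberships of x and xg in D: the four classes have sizes n−1, n, n, n, and
-- (x,y), (xg,yg) both lie in the set exactly when x and y are in the same class
-- and, for the last three classes, distinct.  For the second, y ranges over D
-- for each of the n−1 pairs in D, and over all but two points of the complement
-- for each of the n pairs in the complement; the third is its mirror image.

open import Defs
open import Algebra.Bundles using (Group)
import Algebra.Properties.Group as GroupProperties
open import Data.Empty using (⊥-elim)
open import Data.Fin.Base using (Fin; zero; suc; remQuot; _↑ˡ_; _↑ʳ_)
open import Data.Fin.Permutation using (↔⇒≡)
open import Data.Fin.Properties using (*↔×; remQuot-combine; splitAt-↑ʳ; suc-injective; any?)
  renaming (_≟_ to _≟ᶠ_)
open import Data.Integer.Base using (ℤ; +_; -[1+_]; 0ℤ; 1ℤ; ∣_∣; -_; _+_; _-_)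
  renaming (_*_ to _·_)
import Data.Integer.Properties as ℤ
open import Data.Integer.Tactic.RingSolver using (solve-∀)
open import Data.Nat.Base as ℕ using (ℕ; zero; suc; _*_; _∸_; _≤_)
import Data.Nat.Properties as ℕ
open import Data.Product.Base using (Σ; ∃-syntax; _×_; _,_; proj₁; proj₂)
open import Data.Product.Function.NonDependent.Setoid using (_×-inverse_)
open import Data.Product.Relation.Binary.Pointwise.NonDependent using (_×ₛ_; Pointwise-≡↔≡)
open import Data.Sum.Base using (inj₁; inj₂; [_,_]′)
open import Function.Base using (_∘_; id)
open import Function.Bundles using (Inverse)
open import Function.Construct.Composition using () renaming (inverse to _⨾_)
open import Function.Construct.Symmetry using () renaming (inverse to flip⁻¹)
open import Level using (Level)
open import Relation.Binary.Bundles using (Setoid)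
open import Relation.Binary.Definitions using (_Respects_)
open import Relation.Binary.PropositionalEquality hiding (setoid)
import Relation.Binary.PropositionalEquality.Properties as ≡
open import Relation.Nullary using (¬_; Dec; yes; no)
open import Relation.Nullary.Decidable using (map′)
open import Relation.Unary using (Pred; _∈_; Decidable)
open import Algebra.Properties.Semiring.Sum ℤ.+-*-semiring
  using (sum; sum-cong-≗; sum-replicate-zero; ∑-distrib-+; ∑-comm; *-distribˡ-sum)

private
  variable
    c ℓ p q : Level
    P : Set p
    Q : Set q
    i j : ℤ

-- Integer-valued indicators of propositions.

-- Indexed by the value: matching on an indicator together with its value turns the value into a
-- literal 0 or 1, so idempotence becomes computation. The values lie in `ℤ` because the later
-- identities subtract.
data Indicator (P : Set p) : ℤ → Set p where
  holds : P → Indicator P 1ℤ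
  fails : ¬ P → Indicator P 0ℤ

indicator-unique : Indicator P i → Indicator Q j → (P → Q) → (Q → P) → i ≡ j
indicator-unique (holds p) (holds q) P⇒Q Q⇒P = refl
indicator-unique (holds p) (fails q) P⇒Q Q⇒P = ⊥-elim (q (P⇒Q p))
indicator-unique (fails p) (holds q) P⇒Q Q⇒P = ⊥-elim (p (Q⇒P q))
indicator-unique (fails p) (fails q) P⇒Q Q⇒P = refl

indicator-⇔ : (P → Q) → (Q → P) → Indicator P i → Indicator Q i
indicator-⇔ P⇒Q Q⇒P (holds p) = holds (P⇒Q p)
indicator-⇔ P⇒Q Q⇒P (fails ¬p) = fails (¬p ∘ Q⇒P)

infixr 2 _×ᴵ_

_×ᴵ_ : Indicator P i → Indicator Q j → Indicator (P × Q) (i · j)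
holds p ×ᴵ holds q = holds (p , q)
holds p ×ᴵ fails q = fails (q ∘ proj₂)
fails p ×ᴵ holds q = fails (p ∘ proj₁)
fails p ×ᴵ fails q = fails (p ∘ proj₁)

⟦_⟧ : Dec P → ℤ
⟦ yes _ ⟧ = 1ℤ
⟦ no _ ⟧ = 0ℤ

indicator : (P? : Dec P) → Indicator P ⟦ P? ⟧
indicator (yes p) = holds p
indicator (no ¬p) = fails ¬p

-- Cardinalities of subsets of `Fin N` as sums of indicators.

FinSubset-cardinality : ∀ {N} (P : Pred (Fin N) p) {f} → (∀ x → Indicator (P x) (f x)) →
  ∃[ m ] HasCardinality (Subsetoid (≡.setoid (Fin N)) P) m × + m ≡ sum f
FinSubset-cardinality {N = zero} P ind = 0 , empty , refl
  where
  empty : HasCardinality (Subsetoid (≡.setoid (Fin 0)) P) 0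
  empty = record
    { to = λ () ; from = λ () ; to-cong = λ { {()} } ; from-cong = λ { {()} }
    ; inverse = (λ { {()} }) , λ { {()} } }
FinSubset-cardinality {N = suc N} P {f} ind
  with f zero | ind zero | FinSubset-cardinality (P ∘ suc) (ind ∘ suc)
... | _ | holds p | m , card , eq = suc m , extended , cong (_+_ 1ℤ) eq
  where
  open Inverse card
  to′ : Σ (Fin (suc N)) P → Fin (suc m)
  to′ (zero , _) = zero
  to′ (suc x , q) = suc (to (x , q))
  from′ : Fin (suc m) → Σ (Fin (suc N)) P
  -- Another proof of membership of `zero` is not sent back to itself; that is harmless, since the
  -- subsetoid compares first components only.
  from′ zero = zero , p
  from′ (suc y) = suc (proj₁ (from y)) , proj₂ (from y)
  to∘from : ∀ {y x} → proj₁ x ≡ proj₁ (from′ y) → to′ x ≡ y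
  to∘from {zero} {_ , _} refl = refl
  to∘from {suc y} {_ , _} refl = cong suc (inverseˡ refl)
  from∘to : ∀ {x y} → y ≡ to′ x → proj₁ (from′ y) ≡ proj₁ x
  from∘to {zero , _} refl = refl
  from∘to {suc x , _} refl = cong suc (inverseʳ refl)
  to′-cong : ∀ {x y} → proj₁ x ≡ proj₁ y → to′ x ≡ to′ y
  to′-cong {zero , _} {_ , _} refl = refl
  to′-cong {suc x , _} {_ , _} refl = cong suc (to-cong refl)
  extended : HasCardinality (Subsetoid (≡.setoid (Fin (suc N))) P) (suc m)
  extended = record
    { to = to′ ; from = from′ ; to-cong = to′-cong ; from-cong = cong (proj₁ ∘ from′)
    ; inverse = to∘from , from∘to }
... | _ | fails ¬p | m , card , eq = m , extended , trans eq (sym (ℤ.+-identityˡ _))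
  where
  open Inverse card
  to′ : Σ (Fin (suc N)) P → Fin m
  to′ (zero , q) = ⊥-elim (¬p q)
  to′ (suc x , q) = to (x , q)
  from′ : Fin m → Σ (Fin (suc N)) P
  from′ y = suc (proj₁ (from y)) , proj₂ (from y)
  to∘from : ∀ {y x} → proj₁ x ≡ proj₁ (from′ y) → to′ x ≡ y
  to∘from {y} {_ , _} refl = inverseˡ refl
  from∘to : ∀ {x y} → y ≡ to′ x → proj₁ (from′ y) ≡ proj₁ x
  from∘to {zero , q} _ = ⊥-elim (¬p q)
  from∘to {suc x , _} refl = cong suc (inverseʳ refl)
  to′-cong : ∀ {x y} → proj₁ x ≡ proj₁ y → to′ x ≡ to′ y
  to′-cong {zero , q} _ = ⊥-elim (¬p q)
  to′-cong {suc x , _} {_ , _} refl = to-cong refl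
  extended : HasCardinality (Subsetoid (≡.setoid (Fin (suc N))) P) m
  extended = record
    { to = to′ ; from = from′ ; to-cong = to′-cong ; from-cong = cong (proj₁ ∘ from′)
    ; inverse = to∘from , from∘to }

-- Enumerated setoids and their subsets.

module _ {S : Setoid c ℓ} {N : ℕ} (card : HasCardinality S N) where

  open Setoid S using (Carrier; _≈_) renaming (sym to ≈-sym; trans to ≈-trans)
  open Inverse card

  -- sumOver and δ are opaque so that unification can read off their arguments.
  opaque

    sumOver : (Carrier → ℤ) → ℤ
    sumOver f = sum (f ∘ from)

  infix 4 _≟_
  _≟_ : ∀ x y → Dec (x ≈ y)
  x ≟ y = map′ (λ eq → ≈-trans (≈-sym (strictlyInverseʳ x)) (≈-trans (from-cong eq) (strictlyInverseʳ y)))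
               to-cong (to x ≟ᶠ to y)

  opaque

    δ : Carrier → Carrier → ℤ
    δ x y = ⟦ x ≟ y ⟧

    δ-indicator : ∀ x y → Indicator (x ≈ y) (δ x y)
    δ-indicator x y = indicator (x ≟ y)

  module _ {P : Pred Carrier p} (resp : P Respects _≈_) where

    Subsetoid-pullback : Inverse (Subsetoid S P) (Subsetoid (≡.setoid (Fin N)) (P ∘ from))
    Subsetoid-pullback = record
      { to = λ (x , x∈P) → to x , resp (≈-sym (strictlyInverseʳ x)) x∈P
      ; from = λ (i , i∈P) → from i , i∈P
      ; to-cong = to-cong
      ; from-cong = from-cong
      ; inverse = (λ eq → inverseˡ eq) , (λ eq → inverseʳ eq)
      }

    module _ {f : Carrier → ℤ} (ind : ∀ x → Indicator (P x) (f x)) where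

      opaque
        unfolding sumOver

        cardinality : ∀ {m} → + m ≡ sumOver f → HasCardinality (Subsetoid S P) m
        cardinality eq with FinSubset-cardinality (P ∘ from) (ind ∘ from)
        ... | m , inv , eq′ with refl ← ℤ.+-injective (trans eq (sym eq′)) = Subsetoid-pullback ⨾ inv

        -- The given enumeration and the one built from the indicator compose to a bijection between
        -- two `Fin`s, so their lengths agree.
        cardinality⁻¹ : ∀ {m} → HasCardinality (Subsetoid S P) m → + m ≡ sumOver f
        cardinality⁻¹ inv with FinSubset-cardinality (P ∘ from) (ind ∘ from)
        ... | m , inv′ , eq′ =
          trans (cong +_ (↔⇒≡ (flip⁻¹ inv ⨾ (Subsetoid-pullback ⨾ inv′)))) eq′

-- Products and iterated sums.

infixr 2 _×ᶜ_

_×ᶜ_ : ∀ {c₁ ℓ₁ c₂ ℓ₂} {S : Setoid c₁ ℓ₁} {T : Setoid c₂ ℓ₂} {m n} →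
  HasCardinality S m → HasCardinality T n → HasCardinality (S ×ₛ T) (m * n)
s ×ᶜ t = (s ×-inverse t) ⨾ (Pointwise-≡↔≡ ⨾ flip⁻¹ *↔×)

sum-++ : ∀ m {n} (f : Fin (m ℕ.+ n) → ℤ) → sum f ≡ sum (λ x → f (x ↑ˡ n)) + sum (λ y → f (m ↑ʳ y))
sum-++ zero f = sym (ℤ.+-identityˡ _)
sum-++ (suc m) f = trans (cong (_+_ (f zero)) (sum-++ m (f ∘ suc))) (sym (ℤ.+-assoc (f zero) _ _))

-- `remQuot` enumerates the pairs row by row: the first `n` indices form the row of `zero`, and the
-- others repeat the enumeration for one row fewer.
sum-remQuot : ∀ m n (f : Fin m × Fin n → ℤ) → sum (f ∘ remQuot {m} n) ≡ sum (λ x → sum (λ y → f (x , y)))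
sum-remQuot zero n f = refl
sum-remQuot (suc m) n f = trans (sum-++ n (f ∘ remQuot n)) (cong₂ _+_
  (sum-cong-≗ (λ y → cong f (remQuot-combine {suc m} zero y)))
  (trans (sum-cong-≗ tail) (sum-remQuot m n (λ (x , y) → f (suc x , y)))))
  where
  tail : ∀ z → f (remQuot {suc m} n (n ↑ʳ z)) ≡ f (suc (proj₁ (remQuot {m} n z)) , proj₂ (remQuot {m} n z))
  tail z rewrite splitAt-↑ʳ n (m * n) z = refl

opaque
  unfolding sumOver

  sumOver-× : ∀ {c₁ ℓ₁ c₂ ℓ₂} {S : Setoid c₁ ℓ₁} {T : Setoid c₂ ℓ₂} {m n}
    (s : HasCardinality S m) (t : HasCardinality T n) f →
    sumOver (s ×ᶜ t) f ≡ sumOver s λ x → sumOver t λ y → f (x , y)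
  sumOver-× {m = m} {n} s t f = sum-remQuot m n (λ (i , j) → f (Inverse.from s i , Inverse.from t j))

-- Point sums and sums of squares over `Fin n`.

sum-0 : ∀ {n} {f : Fin n → ℤ} → (∀ i → f i ≡ 0ℤ) → sum f ≡ 0ℤ
sum-0 {n} f≗0 = trans (sum-cong-≗ f≗0) (sum-replicate-zero n)

sum-point : ∀ {n} (j : Fin n) {e f : Fin n → ℤ} → (∀ i → Indicator (i ≡ j) (e i)) →
            sum (λ i → e i · f i) ≡ f j
sum-point zero {e} {f} ind with e zero | ind zero
... | _ | holds _ = trans (cong₂ _+_ (ℤ.*-identityˡ (f zero)) (sum-0 off)) (ℤ.+-identityʳ (f zero))
  where
  off : ∀ i → e (suc i) · f (suc i) ≡ 0ℤ
  off i with e (suc i) | ind (suc i)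
  ... | _ | holds ()
  ... | _ | fails _ = ℤ.*-zeroˡ (f (suc i))
... | _ | fails ≢ = ⊥-elim (≢ refl)
sum-point (suc j) {e} {f} ind with e zero | ind zero
... | _ | fails _ = trans (ℤ.+-identityˡ _) (sum-point j {e ∘ suc} {f ∘ suc} (λ i → weaken (ind (suc i))))
  where
  weaken : ∀ {i a} → Indicator (suc i ≡ suc j) a → Indicator (i ≡ j) a
  weaken (holds eq) = holds (suc-injective eq)
  weaken (fails ≢) = fails (≢ ∘ cong suc)

i*i≡+∣i∣*∣i∣ : ∀ i → i · i ≡ + (∣ i ∣ * ∣ i ∣)
i*i≡+∣i∣*∣i∣ (+ n) = sym (ℤ.pos-* n n)
i*i≡+∣i∣*∣i∣ -[1+ n ] = refl

sum-squares-nonNegative : ∀ {n} (f : Fin n → ℤ) → ∃[ s ] sum (λ i → f i · f i) ≡ + s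
sum-squares-nonNegative {zero} f = 0 , refl
sum-squares-nonNegative {suc n} f with sum-squares-nonNegative (f ∘ suc)
... | s , eq = _ , cong₂ _+_ (i*i≡+∣i∣*∣i∣ (f zero)) eq

-- The first square and the remaining sum are both casts of natural numbers, and natural numbers
-- with sum 0 are 0.
sum-squares≡0 : ∀ {n} (f : Fin n → ℤ) → sum (λ i → f i · f i) ≡ 0ℤ → ∀ i → f i ≡ 0ℤ
sum-squares≡0 {suc n} f ≡0 with sum-squares-nonNegative (f ∘ suc)
... | s , eq = λ
  { zero → ℤ.∣i∣≡0⇒i≡0 ([ id , id ]′ (ℕ.m*n≡0⇒m≡0∨n≡0 ∣ f zero ∣ (ℕ.m+n≡0⇒m≡0 _ total)))
  ; (suc i) → sum-squares≡0 (f ∘ suc) (trans eq (cong +_ (ℕ.m+n≡0⇒n≡0 (∣ f zero ∣ * ∣ f zero ∣) total))) i }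
  where
  total : ∣ f zero ∣ * ∣ f zero ∣ ℕ.+ s ≡ 0
  total = ℤ.+-injective (trans (sym (cong₂ _+_ (i*i≡+∣i∣*∣i∣ (f zero)) eq)) ≡0)

-- Summation calculus on finite setoids.

module _ {S : Setoid c ℓ} {N : ℕ} (card : HasCardinality S N) where

  open Setoid S using (Carrier; _≈_) renaming (sym to ≈-sym)
  open Inverse card

  private
    ∑ : (Carrier → ℤ) → ℤ
    ∑ = sumOver card

  Respecting : (Carrier → ℤ) → Set _
  Respecting f = ∀ {x y} → x ≈ y → f x ≡ f y

  opaque
    unfolding sumOver

    sumOver-cong : ∀ {f g} → (∀ x → f x ≡ g x) → ∑ f ≡ ∑ g
    sumOver-cong eq = sum-cong-≗ (eq ∘ from)

    sumOver-+ : ∀ f g → ∑ (λ x → f x + g x) ≡ ∑ f + ∑ g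
    sumOver-+ f g = ∑-distrib-+ (f ∘ from) (g ∘ from)

    sumOver-*ˡ : ∀ k f → ∑ (λ x → k · f x) ≡ k · ∑ f
    sumOver-*ˡ k f = sym (*-distribˡ-sum k (f ∘ from))

    sumOver-*ʳ : ∀ k f → ∑ (λ x → f x · k) ≡ ∑ f · k
    sumOver-*ʳ k f = trans (sumOver-cong (λ x → ℤ.*-comm (f x) k)) (trans (sumOver-*ˡ k f) (ℤ.*-comm k (∑ f)))

    sumOver-- : ∀ f g → ∑ (λ x → f x - g x) ≡ ∑ f - ∑ g
    sumOver-- f g = trans (sumOver-+ f (-_ ∘ g)) (cong (_+_ (∑ f))
      (trans (sumOver-cong (λ x → sym (ℤ.-1*i≡-i (g x)))) (trans (sumOver-*ˡ (- 1ℤ) g) (ℤ.-1*i≡-i (∑ g)))))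

    sumOver-1 : ∑ (λ _ → 1ℤ) ≡ + N
    sumOver-1 = lemma N
      where
      lemma : ∀ n → sum {n} (λ _ → 1ℤ) ≡ + n
      lemma zero = refl
      lemma (suc n) = cong (_+_ 1ℤ) (lemma n)

    -- The enumeration meets the class of `a` in `from (to a)`, which is only `≈` to `a`; hence `f`
    -- has to respect `≈`.
    sumOver-point : ∀ a {e f : Carrier → ℤ} → Respecting f → (∀ x → Indicator (x ≈ a) (e x)) →
      ∑ (λ x → e x · f x) ≡ f a
    sumOver-point a {e} {f} f-resp ind = trans
      (sum-point (to a) {e ∘ from} {f ∘ from} (λ i → transfer (ind (from i)))) (f-resp (strictlyInverseʳ a))
      where
      transfer : ∀ {i v} → Indicator (from i ≈ a) v → Indicator (i ≡ to a) v
      transfer (holds eq) = holds (trans (sym (strictlyInverseˡ _)) (to-cong eq))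
      transfer (fails ≉) = fails (λ { refl → ≉ (strictlyInverseʳ a) })

    sumOver-squares≡0 : ∀ {f} → Respecting f → ∑ (λ x → f x · f x) ≡ 0ℤ → ∀ x → f x ≡ 0ℤ
    sumOver-squares≡0 {f} f-resp ≡0 x =
      trans (sym (f-resp (strictlyInverseʳ x))) (sum-squares≡0 (f ∘ from) ≡0 (to x))

  module _ {c′ ℓ′} {T : Setoid c′ ℓ′} {M : ℕ} (card′ : HasCardinality T M) where

    opaque
      unfolding sumOver

      sumOver-comm : ∀ (f : Carrier → Setoid.Carrier T → ℤ) →
        ∑ (λ x → sumOver card′ (f x)) ≡ sumOver card′ (λ y → ∑ (λ x → f x y))
      sumOver-comm f = ∑-comm (λ i j → f (from i) (Inverse.from card′ j))

  -- Summing the graph of σ along either coordinate.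
  sumOver-bijection : ∀ {f} (σ τ : Carrier → Carrier) → Respecting f →
    (∀ {x y} → x ≈ σ y → τ x ≈ y) → (∀ {x y} → τ x ≈ y → x ≈ σ y) → ∑ (f ∘ σ) ≡ ∑ f
  sumOver-bijection {f} σ τ f-resp τσ στ = begin
    ∑ (f ∘ σ)
      ≡⟨ sumOver-cong (λ y → sumOver-point (σ y) {λ x → δ card x (σ y)} {f} f-resp
           (λ x → δ-indicator card x (σ y))) ⟨
    ∑ (λ y → ∑ λ x → δ card x (σ y) · f x)
      ≡⟨ sumOver-comm card (λ y x → δ card x (σ y) · f x) ⟩
    ∑ (λ x → ∑ λ y → δ card x (σ y) · f x)
      ≡⟨ sumOver-cong (λ x → sumOver-point (τ x) {λ y → δ card x (σ y)} {λ _ → f x} (λ _ → refl)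
           (λ y → transfer (δ-indicator card x (σ y)))) ⟩
    ∑ f ∎
    where
    open ≡-Reasoning
    transfer : ∀ {x y v} → Indicator (x ≈ σ y) v → Indicator (y ≈ τ x) v
    transfer (holds eq) = holds (≈-sym (τσ eq))
    transfer (fails ≉) = fails (λ eq → ≉ (στ (≈-sym eq)))

sumOver-*-sumOver : ∀ {c₁ ℓ₁ c₂ ℓ₂} {S : Setoid c₁ ℓ₁} {T : Setoid c₂ ℓ₂} {m n}
  (s : HasCardinality S m) (t : HasCardinality T n) f g →
  sumOver s (λ x → sumOver t λ y → f x · g y) ≡ sumOver s f · sumOver t g
sumOver-*-sumOver s t f g = trans (sumOver-cong s (λ x → sumOver-*ˡ t (f x) g)) (sumOver-*ʳ s (sumOver t g) f)

-- Translation-invariant sums over a finite group.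

module GroupSums (G : Group c ℓ) {v : ℕ} (order : HasCardinality (Group.setoid G) v) where

  open Group G using (Carrier; _≈_; _∙_; ε; _⁻¹; ∙-congˡ; ∙-congʳ; assoc; identityˡ; identityʳ)
    renaming (sym to ≈-sym; trans to ≈-trans)
  open GroupProperties G using (\\-leftDividesˡ; \\-leftDividesʳ; //-rightDividesˡ; //-rightDividesʳ)

  infix 5 ∑
  ∑ : (Carrier → ℤ) → ℤ
  ∑ = sumOver order
  syntax ∑ (λ x → e) = ∑[ x ] e

  Respectful : (Carrier → ℤ) → Set _
  Respectful = Respecting order

  private
    variable
      f : Carrier → ℤ

  ∑-shiftˡ : ∀ g → Respectful f → (∑[ x ] f (g ∙ x)) ≡ ∑ f
  ∑-shiftˡ g f-resp = sumOver-bijection order (g ∙_) (g ⁻¹ ∙_) f-resp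
    (λ eq → ≈-trans (∙-congˡ eq) (\\-leftDividesʳ g _))
    (λ eq → ≈-trans (≈-sym (\\-leftDividesˡ g _)) (∙-congˡ eq))

  ∑-shiftʳ : ∀ g → Respectful f → (∑[ x ] f (x ∙ g)) ≡ ∑ f
  ∑-shiftʳ g f-resp = sumOver-bijection order (_∙ g) (_∙ g ⁻¹) f-resp
    (λ eq → ≈-trans (∙-congʳ eq) (//-rightDividesʳ g _))
    (λ eq → ≈-trans (≈-sym (//-rightDividesˡ g _)) (∙-congʳ eq))

  ∑-∑-δ : ∀ (σ : Carrier → Carrier) (F : Carrier → Carrier → ℤ) → (∀ x → Respectful (F x)) →
    (∑[ x ] ∑[ y ] δ order (σ x) y · F x y) ≡ (∑[ x ] F x (σ x))
  ∑-∑-δ σ F F-resp = sumOver-cong order λ x → sumOver-point order (σ x) (F-resp x)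
    (λ y → indicator-⇔ ≈-sym ≈-sym (δ-indicator order (σ x) y))

  ∑-∑-cong : ∀ {F F′ : Carrier → Carrier → ℤ} → (∀ x y → F x y ≡ F′ x y) →
    (∑[ x ] ∑[ y ] F x y) ≡ (∑[ x ] ∑[ y ] F′ x y)
  ∑-∑-cong eq = sumOver-cong order λ x → sumOver-cong order (eq x)

  ∑-∑-+ : ∀ (F F′ : Carrier → Carrier → ℤ) →
    (∑[ x ] ∑[ y ] F x y + F′ x y) ≡ (∑[ x ] ∑[ y ] F x y) + (∑[ x ] ∑[ y ] F′ x y)
  ∑-∑-+ F F′ = trans (sumOver-cong order λ x → sumOver-+ order (F x) (F′ x)) (sumOver-+ order _ _)

  ∑-∑-- : ∀ (F F′ : Carrier → Carrier → ℤ) →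
    (∑[ x ] ∑[ y ] F x y - F′ x y) ≡ (∑[ x ] ∑[ y ] F x y) - (∑[ x ] ∑[ y ] F′ x y)
  ∑-∑-- F F′ = trans (sumOver-cong order λ x → sumOver-- order (F x) (F′ x)) (sumOver-- order _ _)

  -- Equality of the left and right correlations.

  module Correlation (d : Carrier → ℤ) (d-resp : Respectful d) where

    -- When `d` is the indicator of `D`, `corrʳ` is the function a of the introduction and `corrˡ`
    -- is b.
    corrˡ corrʳ : Carrier → ℤ
    corrˡ g = ∑[ x ] d x · d (g ∙ x)
    corrʳ g = ∑[ x ] d x · d (x ∙ g)

    corrˡ-resp : Respectful corrˡ
    corrˡ-resp g≈h = sumOver-cong order λ x → cong (d x ·_) (d-resp (∙-congʳ g≈h))

    corrʳ-resp : Respectful corrʳ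
    corrʳ-resp g≈h = sumOver-cong order λ x → cong (d x ·_) (d-resp (∙-congˡ g≈h))

    corrˡ-ε : corrˡ ε ≡ (∑[ x ] d x · d x)
    corrˡ-ε = sumOver-cong order λ x → cong (d x ·_) (d-resp (identityˡ x))

    corrʳ-ε : corrʳ ε ≡ (∑[ x ] d x · d x)
    corrʳ-ε = sumOver-cong order λ x → cong (d x ·_) (d-resp (identityʳ x))

    -- For fixed `x`, the product `g ∙ x` runs through the whole group as `g` does.
    ∑-corrˡ : ∑ corrˡ ≡ ∑ d · ∑ d
    ∑-corrˡ = begin
      (∑[ g ] ∑[ x ] d x · d (g ∙ x)) ≡⟨ sumOver-comm order order (λ g x → d x · d (g ∙ x)) ⟩
      (∑[ x ] ∑[ g ] d x · d (g ∙ x)) ≡⟨ sumOver-cong order (λ x → ∑-shiftʳ x (cong (d x ·_) ∘ d-resp)) ⟩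
      (∑[ x ] ∑[ g ] d x · d g)       ≡⟨ sumOver-*-sumOver order order d d ⟩
      ∑ d · ∑ d                       ∎
      where open ≡-Reasoning

    ∑-corrʳ : ∑ corrʳ ≡ ∑ d · ∑ d
    ∑-corrʳ = begin
      (∑[ g ] ∑[ x ] d x · d (x ∙ g)) ≡⟨ sumOver-comm order order (λ g x → d x · d (x ∙ g)) ⟩
      (∑[ x ] ∑[ g ] d x · d (x ∙ g)) ≡⟨ sumOver-cong order (λ x → ∑-shiftˡ x (cong (d x ·_) ∘ d-resp)) ⟩
      (∑[ x ] ∑[ g ] d x · d g)       ≡⟨ sumOver-*-sumOver order order d d ⟩
      ∑ d · ∑ d                       ∎
      where open ≡-Reasoning

    -- Both sides weigh the rectangles with corners `x`, `x ∙ g`, `h ∙ x` and `h ∙ x ∙ g`: on the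
    -- left as two pairs with the same right factor `g`, on the right as two pairs with the same
    -- left factor `h`. Associativity makes the fourth corner common to both readings.
    ∑-corrʳ² : (∑[ g ] corrʳ g · corrʳ g) ≡ (∑[ h ] corrˡ h · corrˡ h)
    ∑-corrʳ² = begin
      (∑[ g ] corrʳ g · corrʳ g)
        ≡⟨ sumOver-cong order (λ g → sumOver-*-sumOver order order (λ x → d x · d (x ∙ g)) (λ y → d y · d (y ∙ g))) ⟨
      (∑[ g ] ∑[ x ] ∑[ y ] (d x · d (x ∙ g)) · (d y · d (y ∙ g)))
        -- Substitute `y = h ∙ x`, so that `h` replaces `y` as the free variable.
        ≡⟨ ∑-∑-cong (λ g x → ∑-shiftʳ x (λ eq → cong₂ (λ a b → (d x · d (x ∙ g)) · (a · b)) (d-resp eq) (d-resp (∙-congʳ eq)))) ⟨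
      (∑[ g ] ∑[ x ] ∑[ h ] (d x · d (x ∙ g)) · (d (h ∙ x) · d ((h ∙ x) ∙ g)))
        ≡⟨ sumOver-comm order order (λ g x → ∑[ h ] (d x · d (x ∙ g)) · (d (h ∙ x) · d ((h ∙ x) ∙ g))) ⟩
      (∑[ x ] ∑[ g ] ∑[ h ] (d x · d (x ∙ g)) · (d (h ∙ x) · d ((h ∙ x) ∙ g)))
        ≡⟨ sumOver-cong order (λ x → sumOver-comm order order (λ g h → (d x · d (x ∙ g)) · (d (h ∙ x) · d ((h ∙ x) ∙ g)))) ⟩
      (∑[ x ] ∑[ h ] ∑[ g ] (d x · d (x ∙ g)) · (d (h ∙ x) · d ((h ∙ x) ∙ g)))
        ≡⟨ sumOver-comm order order (λ x h → ∑[ g ] (d x · d (x ∙ g)) · (d (h ∙ x) · d ((h ∙ x) ∙ g))) ⟩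
      (∑[ h ] ∑[ x ] ∑[ g ] (d x · d (x ∙ g)) · (d (h ∙ x) · d ((h ∙ x) ∙ g)))
        ≡⟨ ∑-∑-cong (λ h x → sumOver-cong order (λ g → trans
             (cong (λ a → (d x · d (x ∙ g)) · (d (h ∙ x) · a)) (d-resp (assoc h x g)))
             (interchange (d x) (d (x ∙ g)) (d (h ∙ x)) (d (h ∙ (x ∙ g)))))) ⟩
      (∑[ h ] ∑[ x ] ∑[ g ] (d x · d (h ∙ x)) · (d (x ∙ g) · d (h ∙ (x ∙ g))))
        -- Now `z = x ∙ g` replaces `g`, and the summand separates for fixed `h`.
        ≡⟨ ∑-∑-cong (λ h x → ∑-shiftˡ x (λ eq → cong₂ (λ a b → (d x · d (h ∙ x)) · (a · b)) (d-resp eq) (d-resp (∙-congˡ eq)))) ⟩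
      (∑[ h ] ∑[ x ] ∑[ z ] (d x · d (h ∙ x)) · (d z · d (h ∙ z)))
        ≡⟨ sumOver-cong order (λ h → sumOver-*-sumOver order order (λ x → d x · d (h ∙ x)) (λ z → d z · d (h ∙ z))) ⟩
      (∑[ h ] corrˡ h · corrˡ h) ∎
      where
      open ≡-Reasoning
      interchange : ∀ a b c d → (a · b) · (c · d) ≡ (a · c) · (b · d)
      interchange = solve-∀

    module _ {lam : ℤ} (corrˡ-const : ∀ g → ¬ (g ≈ ε) → corrˡ g ≡ lam) where

      corrˡ-formula : ∀ g → corrˡ g ≡ lam + (corrˡ ε - lam) · δ order g ε
      corrˡ-formula g with δ order g ε | δ-indicator order g ε
      ... | _ | holds g≈ε = trans (corrˡ-resp g≈ε) (lemma lam (corrˡ ε))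
        where
        lemma : ∀ l k → k ≡ l + (k - l) · 1ℤ
        lemma = solve-∀
      ... | _ | fails g≉ε = trans (corrˡ-const g g≉ε) (lemma lam (corrˡ ε))
        where
        lemma : ∀ l k → l ≡ l + (k - l) · 0ℤ
        lemma = solve-∀

      -- `corrˡ` is a constant plus a multiple of the point mass at `ε`, so pairing with it sees
      -- only the total of `f` and its value at `ε`.
      ∑-*-corrˡ : Respectful f → (∑[ g ] f g · corrˡ g) ≡ lam · ∑ f + (corrˡ ε - lam) · f ε
      ∑-*-corrˡ {f} f-resp = begin
        (∑[ g ] f g · corrˡ g)
          ≡⟨ sumOver-cong order (λ g → trans (cong (f g ·_) (corrˡ-formula g)) (lemma (f g) lam (corrˡ ε - lam) (δ order g ε))) ⟩
        (∑[ g ] lam · f g + (corrˡ ε - lam) · (δ order g ε · f g))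
          ≡⟨ sumOver-+ order (λ g → lam · f g) (λ g → (corrˡ ε - lam) · (δ order g ε · f g)) ⟩
        (∑[ g ] lam · f g) + (∑[ g ] (corrˡ ε - lam) · (δ order g ε · f g))
          ≡⟨ cong₂ _+_ (sumOver-*ˡ order lam f) (trans (sumOver-*ˡ order (corrˡ ε - lam) (λ g → δ order g ε · f g))
               (cong ((corrˡ ε - lam) ·_) (sumOver-point order ε f-resp (λ g → δ-indicator order g ε)))) ⟩
        lam · ∑ f + (corrˡ ε - lam) · f ε ∎
        where
        open ≡-Reasoning
        lemma : ∀ x l m t → x · (l + m · t) ≡ l · x + m · (t · x)
        lemma = solve-∀

      -- The two data of `corrʳ` seen by `∑-*-corrˡ`, its total and its value at `ε`, coincide with
      -- those of `corrˡ`.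
      ∑-corrʳ*corrˡ : (∑[ g ] corrʳ g · corrˡ g) ≡ (∑[ g ] corrˡ g · corrˡ g)
      ∑-corrʳ*corrˡ = begin
        (∑[ g ] corrʳ g · corrˡ g)                    ≡⟨ ∑-*-corrˡ corrʳ-resp ⟩
        lam · ∑ corrʳ + (corrˡ ε - lam) · corrʳ ε     ≡⟨ cong₂ (λ a b → lam · a + (corrˡ ε - lam) · b)
                                                              (trans ∑-corrʳ (sym ∑-corrˡ)) (trans corrʳ-ε (sym corrˡ-ε)) ⟩
        lam · ∑ corrˡ + (corrˡ ε - lam) · corrˡ ε     ≡⟨ ∑-*-corrˡ corrˡ-resp ⟨
        (∑[ g ] corrˡ g · corrˡ g)                    ∎
        where open ≡-Reasoning

      corrʳ≡corrˡ : ∀ g → corrʳ g ≡ corrˡ g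
      corrʳ≡corrˡ g = ℤ.i-j≡0⇒i≡j (corrʳ g) (corrˡ g)
        (sumOver-squares≡0 order {λ g → corrʳ g - corrˡ g} (λ eq → cong₂ _-_ (corrʳ-resp eq) (corrˡ-resp eq)) squares g)
        where
        open ≡-Reasoning
        expand : ∀ a b → (a - b) · (a - b) ≡ (a · a - a · b) - (a · b - b · b)
        expand = solve-∀
        cancel : ∀ s → (s - s) - (s - s) ≡ 0ℤ
        cancel = solve-∀
        squares : (∑[ g ] (corrʳ g - corrˡ g) · (corrʳ g - corrˡ g)) ≡ 0ℤ
        squares = begin
          (∑[ g ] (corrʳ g - corrˡ g) · (corrʳ g - corrˡ g))
            ≡⟨ sumOver-cong order (λ g → expand (corrʳ g) (corrˡ g)) ⟩
          (∑[ g ] (corrʳ g · corrʳ g - corrʳ g · corrˡ g) - (corrʳ g · corrˡ g - corrˡ g · corrˡ g))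
            ≡⟨ sumOver-- order (λ g → corrʳ g · corrʳ g - corrʳ g · corrˡ g) (λ g → corrʳ g · corrˡ g - corrˡ g · corrˡ g) ⟩
          (∑[ g ] corrʳ g · corrʳ g - corrʳ g · corrˡ g) - (∑[ g ] corrʳ g · corrˡ g - corrˡ g · corrˡ g)
            ≡⟨ cong₂ _-_ (sumOver-- order (λ g → corrʳ g · corrʳ g) (λ g → corrʳ g · corrˡ g))
                         (sumOver-- order (λ g → corrʳ g · corrˡ g) (λ g → corrˡ g · corrˡ g)) ⟩
          ((∑[ g ] corrʳ g · corrʳ g) - (∑[ g ] corrʳ g · corrˡ g)) - ((∑[ g ] corrʳ g · corrˡ g) - (∑[ g ] corrˡ g · corrˡ g))
            -- All four sums are now equal to the sum of the squares of `corrˡ`.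
            ≡⟨ cong₂ (λ a b → (a - b) - (b - (∑[ g ] corrˡ g · corrˡ g))) ∑-corrʳ² ∑-corrʳ*corrˡ ⟩
          ((∑[ g ] corrˡ g · corrˡ g) - (∑[ g ] corrˡ g · corrˡ g)) - ((∑[ g ] corrˡ g · corrˡ g) - (∑[ g ] corrˡ g · corrˡ g))
            ≡⟨ cancel (∑[ g ] corrˡ g · corrˡ g) ⟩
          0ℤ ∎

-- Counting with the characteristic function of the square union.

module SquareUnion (G : Group c ℓ) {v : ℕ} (order : HasCardinality (Group.setoid G) v)
  {D : Pred (Group.Carrier G) p} (D-resp : D Respects (Group._≈_ G))
  {d : Group.Carrier G → ℤ} (d-ind : ∀ x → Indicator (x ∈ D) (d x)) where

  open Group G using (Carrier; _≈_; _∙_; ε; ∙-congʳ)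
    renaming (sym to ≈-sym; trans to ≈-trans)
  open GroupProperties G using (∙-cancelʳ; identityˡ-unique)
  open GroupSums G order

  d-resp : Respectful d
  d-resp x≈y = indicator-unique (d-ind _) (d-ind _) (D-resp x≈y) (D-resp (≈-sym x≈y))

  open Correlation d d-resp

  d̄ : Carrier → ℤ
  d̄ x = 1ℤ - d x

  d̄-resp : Respectful d̄
  d̄-resp x≈y = cong (_-_ 1ℤ) (d-resp x≈y)

  δ-resp : ∀ {x y x′ y′} → x ≈ x′ → y ≈ y′ → δ order x y ≡ δ order x′ y′
  δ-resp x≈ y≈ = indicator-unique (δ-indicator order _ _) (δ-indicator order _ _)
    (λ eq → ≈-trans (≈-sym x≈) (≈-trans eq y≈)) (λ eq → ≈-trans x≈ (≈-trans eq (≈-sym y≈)))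

  χ : Carrier → Carrier → ℤ
  χ x y = d x · d y + d̄ x · d̄ y · (1ℤ - δ order x y)

  χ-indicator : ∀ z → Indicator (z ∈ squareUnion G D) (χ (proj₁ z) (proj₂ z))
  χ-indicator (x , y) with d x | d-ind x | d y | d-ind y | δ order x y | δ-indicator order x y
  ... | _ | holds x∈ | _ | holds y∈ | _ | holds x≈y = holds (inj₁ (x∈ , y∈))
  ... | _ | holds x∈ | _ | holds y∈ | _ | fails x≉y = holds (inj₁ (x∈ , y∈))
  ... | _ | holds x∈ | _ | fails y∉ | _ | holds x≈y = ⊥-elim (y∉ (D-resp x≈y x∈))
  ... | _ | holds x∈ | _ | fails y∉ | _ | fails x≉y =
    fails λ { (inj₁ (_ , y∈)) → y∉ y∈ ; (inj₂ ((x∉ , _) , _)) → x∉ x∈ }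
  ... | _ | fails x∉ | _ | holds y∈ | _ | holds x≈y = ⊥-elim (x∉ (D-resp (≈-sym x≈y) y∈))
  ... | _ | fails x∉ | _ | holds y∈ | _ | fails x≉y =
    fails λ { (inj₁ (x∈ , _)) → x∉ x∈ ; (inj₂ ((_ , y∉) , _)) → y∉ y∈ }
  ... | _ | fails x∉ | _ | fails y∉ | _ | holds x≈y =
    fails λ { (inj₁ (x∈ , _)) → x∉ x∈ ; (inj₂ (_ , off)) → off (x∉ , x≈y) }
  ... | _ | fails x∉ | _ | fails y∉ | _ | fails x≉y = holds (inj₂ ((x∉ , y∉) , x≉y ∘ proj₂))

  χ-resp : ∀ {x y x′ y′} → x ≈ x′ → y ≈ y′ → χ x y ≡ χ x′ y′
  χ-resp x≈ y≈ = cong₂ _+_ (cong₂ _·_ (d-resp x≈) (d-resp y≈))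
    (cong₂ _·_ (cong₂ _·_ (d̄-resp x≈) (d̄-resp y≈)) (cong (_-_ 1ℤ) (δ-resp x≈ y≈)))

  χ-sym : ∀ x y → χ x y ≡ χ y x
  χ-sym x y = cong₂ _+_ (ℤ.*-comm (d x) (d y)) (cong₂ _·_ (ℤ.*-comm (d̄ x) (d̄ y))
    (cong (_-_ 1ℤ) (indicator-unique (δ-indicator order x y) (δ-indicator order y x) ≈-sym ≈-sym)))

  k : ℤ
  k = ∑ d

  ∑-d̄ : ∑ d̄ ≡ + v - k
  ∑-d̄ = trans (sumOver-- order (λ _ → 1ℤ) d) (cong (_- k) (sumOver-1 order))

  d̄-idem : ∀ x → d̄ x · d̄ x ≡ d̄ x
  d̄-idem x with d x | d-ind x
  ... | _ | holds _ = refl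
  ... | _ | fails _ = refl

  -- `D` contributes all its pairs; its complement, of size `+ v - k`, contributes all pairs but the
  -- diagonal ones.
  ∑-χ : (∑[ x ] ∑[ y ] χ x y) ≡ k · k + ((+ v - k) · (+ v - k) - (+ v - k))
  ∑-χ = begin
    (∑[ x ] ∑[ y ] χ x y)
      ≡⟨ ∑-∑-cong (λ x y → lemma (d x) (d y) (d̄ x) (d̄ y) (δ order x y)) ⟩
    (∑[ x ] ∑[ y ] d x · d y + (d̄ x · d̄ y - δ order x y · (d̄ x · d̄ y)))
      ≡⟨ trans (∑-∑-+ (λ x y → d x · d y) _) (cong₂ _+_ (sumOver-*-sumOver order order d d)
           (trans (∑-∑-- (λ x y → d̄ x · d̄ y) (λ x y → δ order x y · (d̄ x · d̄ y)))
             (cong₂ _-_ (sumOver-*-sumOver order order d̄ d̄)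
               (trans (∑-∑-δ (λ x → x) (λ x y → d̄ x · d̄ y) (λ x → cong (d̄ x ·_) ∘ d̄-resp))
                 (sumOver-cong order d̄-idem))))) ⟩
    k · k + (∑ d̄ · ∑ d̄ - ∑ d̄)
      ≡⟨ cong (λ s → k · k + (s · s - s)) ∑-d̄ ⟩
    k · k + ((+ v - k) · (+ v - k) - (+ v - k)) ∎
    where
    open ≡-Reasoning
    lemma : ∀ e f e̅ f̅ t → e · f + e̅ · f̅ · (1ℤ - t) ≡ e · f + (e̅ · f̅ - t · (e̅ · f̅))
    lemma = solve-∀

  module _ (σ : Carrier → Carrier) (σ-bij : ∀ {f} → Respectful f → ∑ (f ∘ σ) ≡ ∑ f) where

    both : ℤ
    both = ∑[ x ] d x · d (σ x)

    ∑-d*d̄ : (∑[ x ] d x · d̄ (σ x)) ≡ k - both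
    ∑-d*d̄ = trans (sumOver-cong order (λ x → lemma (d x) (d (σ x)))) (sumOver-- order d (λ x → d x · d (σ x)))
      where
      lemma : ∀ a b → a · (1ℤ - b) ≡ a - a · b
      lemma = solve-∀

    -- As `σ` is a bijection, `σ x` lies in `D` for exactly `k` points `x`. This makes all four
    -- joint membership counts functions of `both`.
    ∑-d̄*d : (∑[ x ] d̄ x · d (σ x)) ≡ k - both
    ∑-d̄*d = trans (sumOver-cong order (λ x → lemma (d x) (d (σ x))))
      (trans (sumOver-- order (d ∘ σ) (λ x → d x · d (σ x))) (cong (_- both) (σ-bij d-resp)))
      where
      lemma : ∀ a b → (1ℤ - a) · b ≡ b - a · b
      lemma = solve-∀

    ∑-d̄*d̄ : (∑[ x ] d̄ x · d̄ (σ x)) ≡ (+ v - k) - (k - both)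
    ∑-d̄*d̄ = trans (sumOver-cong order (λ x → lemma (d̄ x) (d (σ x))))
      (trans (sumOver-- order d̄ (λ x → d̄ x · d (σ x))) (cong₂ _-_ ∑-d̄ ∑-d̄*d))
      where
      lemma : ∀ a b → a · (1ℤ - b) ≡ a - a · b
      lemma = solve-∀

  -- `a`, `b`, `b`, `e` are the sizes of the four classes. Diagonal pairs survive only in the first
  -- class: in each of the others, `x` or `x ∙ g` lies outside `D`, where the diagonal is excluded.
  ∑-diagonal-shift : ∀ g → (∑[ x ] ∑[ y ] χ x y · χ (x ∙ g) (y ∙ g)) ≡
    (let a = corrʳ g ; b = k - a ; e = (+ v - k) - b in
     (a · a + b · b + (b · b + e · e)) - (b + b + e))
  ∑-diagonal-shift g = begin
    (∑[ x ] ∑[ y ] χ x y · χ (x ∙ g) (y ∙ g))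
      ≡⟨ ∑-∑-cong pointwise ⟩
    (∑[ x ] ∑[ y ] (A x · A y + B x · B y + (C x · C y + E x · E y)) - δ order x y · R x y)
      ≡⟨ ∑-∑-- (λ x y → A x · A y + B x · B y + (C x · C y + E x · E y)) (λ x y → δ order x y · R x y) ⟩
    (∑[ x ] ∑[ y ] A x · A y + B x · B y + (C x · C y + E x · E y)) - (∑[ x ] ∑[ y ] δ order x y · R x y)
      ≡⟨ cong₂ _-_
           (trans (∑-∑-+ (λ x y → A x · A y + B x · B y) (λ x y → C x · C y + E x · E y))
             (cong₂ _+_
               (trans (∑-∑-+ (λ x y → A x · A y) (λ x y → B x · B y))
                 (cong₂ _+_ (square A) (square B)))
               (trans (∑-∑-+ (λ x y → C x · C y) (λ x y → E x · E y))
                 (cong₂ _+_ (square C) (square E)))))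
           (trans (∑-∑-δ (λ x → x) R R-resp) (trans (sumOver-cong order R-diagonal)
             (trans (sumOver-+ order (λ x → B x + C x) E) (cong (_+ ∑ E) (sumOver-+ order B C))))) ⟩
    (∑ A · ∑ A + ∑ B · ∑ B + (∑ C · ∑ C + ∑ E · ∑ E)) - (∑ B + ∑ C + ∑ E)
      ≡⟨ cong₂ (λ b c → (∑ A · ∑ A + b · b + (c · c + ∑ E · ∑ E)) - (b + c + ∑ E))
           (∑-d*d̄ (_∙ g) (∑-shiftʳ g)) (∑-d̄*d (_∙ g) (∑-shiftʳ g)) ⟩
    (∑ A · ∑ A + (k - ∑ A) · (k - ∑ A) + ((k - ∑ A) · (k - ∑ A) + ∑ E · ∑ E)) - ((k - ∑ A) + (k - ∑ A) + ∑ E)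
      ≡⟨ cong (λ e → (∑ A · ∑ A + (k - ∑ A) · (k - ∑ A) + ((k - ∑ A) · (k - ∑ A) + e · e)) - ((k - ∑ A) + (k - ∑ A) + e))
           (∑-d̄*d̄ (_∙ g) (∑-shiftʳ g)) ⟩
    _ ∎
    where
    open ≡-Reasoning
    A B C E : Carrier → ℤ
    A x = d x · d (x ∙ g)
    B x = d x · d̄ (x ∙ g)
    C x = d̄ x · d (x ∙ g)
    E x = d̄ x · d̄ (x ∙ g)
    R : Carrier → Carrier → ℤ
    R x y = B x · B y + C x · C y + E x · E y
    R-resp : ∀ x → Respectful (R x)
    R-resp x eq = cong₂ (λ u w → B x · (u · (1ℤ - w)) + C x · ((1ℤ - u) · w) + E x · ((1ℤ - u) · (1ℤ - w)))
      (d-resp eq) (d-resp (∙-congʳ eq))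
    R-diagonal : ∀ x → R x x ≡ B x + C x + E x
    R-diagonal x with d x | d-ind x | d (x ∙ g) | d-ind (x ∙ g)
    ... | _ | holds _ | _ | holds _ = refl
    ... | _ | holds _ | _ | fails _ = refl
    ... | _ | fails _ | _ | holds _ = refl
    ... | _ | fails _ | _ | fails _ = refl
    square : ∀ F → (∑[ x ] ∑[ y ] F x · F y) ≡ ∑ F · ∑ F
    square F = sumOver-*-sumOver order order F F
    -- The left side is quadratic in `t` and the right side linear, so the identity needs `t` to be
    -- 0 or 1; the other variables are arbitrary.
    lemma : ∀ {q} {Q : Set q} {t} → Indicator Q t → ∀ e e′ f f′ →
      (e · f + (1ℤ - e) · (1ℤ - f) · (1ℤ - t)) · (e′ · f′ + (1ℤ - e′) · (1ℤ - f′) · (1ℤ - t)) ≡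
      (e · e′) · (f · f′) + (e · (1ℤ - e′)) · (f · (1ℤ - f′))
        + (((1ℤ - e) · e′) · ((1ℤ - f) · f′) + ((1ℤ - e) · (1ℤ - e′)) · ((1ℤ - f) · (1ℤ - f′)))
        - t · ((e · (1ℤ - e′)) · (f · (1ℤ - f′)) + ((1ℤ - e) · e′) · ((1ℤ - f) · f′)
                + ((1ℤ - e) · (1ℤ - e′)) · ((1ℤ - f) · (1ℤ - f′)))
    lemma (holds _) = solve-∀
    lemma (fails _) = solve-∀
    pointwise : ∀ x y → χ x y · χ (x ∙ g) (y ∙ g) ≡
      (A x · A y + B x · B y + (C x · C y + E x · E y)) - δ order x y · R x y
    pointwise x y = trans
      -- Right translation by `g` preserves and reflects equality, so both factors share one `t`.
      (cong (λ t → χ x y · (d (x ∙ g) · d (y ∙ g) + d̄ (x ∙ g) · d̄ (y ∙ g) · (1ℤ - t)))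
        (indicator-unique (δ-indicator order (x ∙ g) (y ∙ g)) (δ-indicator order x y) (∙-cancelʳ g x y) ∙-congʳ))
      (lemma (δ-indicator order x y) (d x) (d (x ∙ g)) (d y) (d (y ∙ g)))

  -- A point `y` of `D` needs `x` and `g ∙ x` in `D`, giving `a · k`. A point `y` of the complement
  -- needs both outside `D` and different from `y`; each of the `e` such `x` therefore loses the two
  -- choices `y = x` and `y = g ∙ x`, distinct because `g` is not `ε`.
  ∑-left-shift : ∀ g → ¬ (g ≈ ε) → (∑[ x ] ∑[ y ] χ x y · χ (g ∙ x) y) ≡
    (let a = corrˡ g ; e = (+ v - k) - (k - a) in a · k + (e · (+ v - k) - e - e))
  ∑-left-shift g g≉ε = begin
    (∑[ x ] ∑[ y ] χ x y · χ (g ∙ x) y)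
      ≡⟨ ∑-∑-cong pointwise ⟩
    (∑[ x ] ∑[ y ] A x · d y + (E x · d̄ y - δ order x y · (E x · d̄ y) - δ order (g ∙ x) y · (E x · d̄ y)))
      ≡⟨ trans (∑-∑-+ (λ x y → A x · d y) _) (cong₂ _+_ (sumOver-*-sumOver order order A d)
           (trans (∑-∑-- (λ x y → E x · d̄ y - δ order x y · (E x · d̄ y)) (λ x y → δ order (g ∙ x) y · (E x · d̄ y)))
           (cong₂ _-_
             (trans (∑-∑-- (λ x y → E x · d̄ y) (λ x y → δ order x y · (E x · d̄ y)))
               (cong₂ _-_ (sumOver-*-sumOver order order E d̄)
                 (trans (∑-∑-δ (λ x → x) (λ x y → E x · d̄ y) (λ x → cong (E x ·_) ∘ d̄-resp))
                   (sumOver-cong order absorbˡ))))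
             (trans (∑-∑-δ (g ∙_) (λ x y → E x · d̄ y) (λ x → cong (E x ·_) ∘ d̄-resp))
               (sumOver-cong order absorbʳ))))) ⟩
    ∑ A · k + (∑ E · ∑ d̄ - ∑ E - ∑ E)
      ≡⟨ cong₂ (λ e k̅ → ∑ A · k + (e · k̅ - e - e)) (∑-d̄*d̄ (g ∙_) (∑-shiftˡ g)) ∑-d̄ ⟩
    _ ∎
    where
    open ≡-Reasoning
    A E : Carrier → ℤ
    A x = d x · d (g ∙ x)
    E x = d̄ x · d̄ (g ∙ x)
    absorbˡ : ∀ x → E x · d̄ x ≡ E x
    absorbˡ x with d x | d-ind x
    ... | _ | holds _ = refl
    ... | _ | fails _ = ℤ.*-identityʳ _
    absorbʳ : ∀ x → E x · d̄ (g ∙ x) ≡ E x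
    absorbʳ x = trans (ℤ.*-assoc (d̄ x) _ _) (cong (d̄ x ·_) (d̄-idem (g ∙ x)))
    lemma : ∀ {q r s} {Q : Set q} {R : Set r} {S : Set s} {f t u} → Indicator Q f → Indicator R t → Indicator S u →
      (R → ¬ S) → ∀ e e′ →
      (e · f + (1ℤ - e) · (1ℤ - f) · (1ℤ - t)) · (e′ · f + (1ℤ - e′) · (1ℤ - f) · (1ℤ - u)) ≡
      (e · e′) · f + (((1ℤ - e) · (1ℤ - e′)) · (1ℤ - f) - t · (((1ℤ - e) · (1ℤ - e′)) · (1ℤ - f))
                       - u · (((1ℤ - e) · (1ℤ - e′)) · (1ℤ - f)))
    -- Expanding the two diagonal factors leaves a term in `t · u`, which exclusivity removes.
    lemma _         (holds r) (holds s) excl = ⊥-elim (excl r s)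
    lemma (holds _) (holds _) (fails _) _ = solve-∀
    lemma (holds _) (fails _) (holds _) _ = solve-∀
    lemma (holds _) (fails _) (fails _) _ = solve-∀
    lemma (fails _) (holds _) (fails _) _ = solve-∀
    lemma (fails _) (fails _) (holds _) _ = solve-∀
    lemma (fails _) (fails _) (fails _) _ = solve-∀
    pointwise : ∀ x y → χ x y · χ (g ∙ x) y ≡
      A x · d y + (E x · d̄ y - δ order x y · (E x · d̄ y) - δ order (g ∙ x) y · (E x · d̄ y))
    pointwise x y = lemma (d-ind y) (δ-indicator order x y) (δ-indicator order (g ∙ x) y)
      (λ x≈y gx≈y → g≉ε (identityˡ-unique g x (≈-trans gx≈y (≈-sym x≈y)))) (d x) (d (g ∙ x))

-- Tools for assembling the counts.

-- The nesting of the factors is the one produced by chained uses of `_×ᴵ_`.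
sumOver-point-× : ∀ {S : Setoid c ℓ} {N} (card : HasCardinality S N) {a b} (k : ℤ)
  {e f : Setoid.Carrier S → ℤ} (F : Setoid.Carrier S → Setoid.Carrier S → ℤ) →
  (∀ {x y x′ y′} → Setoid._≈_ S x x′ → Setoid._≈_ S y y′ → F x y ≡ F x′ y′) →
  (∀ x → Indicator (Setoid._≈_ S x a) (e x)) → (∀ y → Indicator (Setoid._≈_ S y b) (f y)) →
  sumOver (card ×ᶜ card) (λ (x , y) → k · (F x y · (e x · f y))) ≡ k · F a b
sumOver-point-× {S = S} card {a} {b} k {e} {f} F F-resp e-ind f-ind = begin
  sumOver (card ×ᶜ card) (λ (x , y) → k · (F x y · (e x · f y)))
    ≡⟨ sumOver-× card card (λ (x , y) → k · (F x y · (e x · f y))) ⟩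
  (sumOver card λ x → sumOver card λ y → k · (F x y · (e x · f y)))
    ≡⟨ sumOver-cong card (λ x → trans
         (sumOver-cong card (λ y → lemma k (F x y) (e x) (f y)))
         (sumOver-point card b (λ eq → cong (λ z → e x · (k · z)) (F-resp S.refl eq)) f-ind)) ⟩
  (sumOver card λ x → e x · (k · F x b))
    ≡⟨ sumOver-point card a (λ eq → cong (k ·_) (F-resp eq S.refl)) e-ind ⟩
  k · F a b ∎
  where
  module S = Setoid S
  open ≡-Reasoning
  lemma : ∀ k F e f → k · (F · (e · f)) ≡ f · (e · (k · F))
  lemma = solve-∀

-- Search the finite list of elements of `D`, using the decidable equality of the enumerated setoid.
Subsetoid-decidable : ∀ {S : Setoid c ℓ} {N} (card : HasCardinality S N) {D : Pred (Setoid.Carrier S) p} →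
  D Respects (Setoid._≈_ S) → ∀ {k} → HasCardinality (Subsetoid S D) k → Decidable D
Subsetoid-decidable card D-resp size x =
  map′ (λ (i , eq) → D-resp eq (proj₂ (from i))) (λ x∈D → to (x , x∈D) , strictlyInverseʳ (x , x∈D))
       (any? (λ i → _≟_ card (proj₁ (from i)) x))
  where open Inverse size

pos-∸ : ∀ {m n} → n ≤ m → + (m ∸ n) ≡ + m - + n
pos-∸ {m} {n} n≤m = sym (trans (ℤ.m-n≡m⊖n m n) (ℤ.⊖-≥ n≤m))

-- Paley parameters and the three propriety conditions.

module _ {G : Group c ℓ} {D : Pred (Group.Carrier G) p} {n : ℕ} (1≤n : 1 ≤ n)
  (paley : IsDifferenceSet G (4 * n ∸ 1) (2 * n ∸ 1) (n ∸ 1) D) where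

  open Group G using (Carrier; _≈_; _∙_; ε; _⁻¹; setoid; ∙-congˡ; ∙-congʳ; ⁻¹-cong; ∙-cong)
    renaming (sym to ≈-sym; trans to ≈-trans)
  open GroupProperties G
    using (\\-leftDividesʳ; \\-leftDividesˡ; //-rightDividesˡ; x≈z//y; y≈x\\z; ⁻¹-involutive; ε⁻¹≈ε)
  open IsDifferenceSet paley

  private
    G² : Setoid c ℓ
    G² = setoid ×ₛ setoid

  D? : Decidable D
  D? = Subsetoid-decidable order respects size

  opaque

    d : Carrier → ℤ
    d x = ⟦ D? x ⟧

    d-ind : ∀ x → Indicator (x ∈ D) (d x)
    d-ind x = indicator (D? x)

  open GroupSums G order
  open SquareUnion G order respects d-ind
  open Correlation d d-resp

  order² : HasCardinality G² _
  order² = order ×ᶜ order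

  ν : ℤ
  ν = + n

  -- As `1 ≤ n`, the truncated subtraction is exact and the parameters become polynomials in `ν`.
  pos-*∸1 : ∀ m .{{_ : ℕ.NonZero m}} → + (m * n ∸ 1) ≡ + m · ν - 1ℤ
  pos-*∸1 m = trans (pos-∸ (ℕ.≤-trans 1≤n (ℕ.m≤n*m n m))) (cong (_- 1ℤ) (ℤ.pos-* m n))

  pos-n∸1 : + (n ∸ 1) ≡ ν - 1ℤ
  pos-n∸1 = pos-∸ 1≤n

  k-value : k ≡ + 2 · ν - 1ℤ
  k-value = trans (sym (cardinality⁻¹ order respects d-ind size)) (pos-*∸1 2)

  -- Each propriety condition relates the coordinates by the graph of a translation or of the
  -- identity, so one counting lemma serves all three.
  Graph : ∀ {r} → (Carrier → Carrier → Set r) → (Carrier → Carrier) → Set _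
  Graph R σ = ∀ {x y} → (R x y → y ≈ σ x) × (y ≈ σ x → R x y)

  graph-indicator : ∀ {r} {R : Carrier → Carrier → Set r} {σ} → Graph R σ →
    ∀ x y → Indicator (R x y) (δ order y (σ x))
  graph-indicator R-graph x y = indicator-⇔ (proj₂ R-graph) (proj₁ R-graph) (δ-indicator order y _)

  graph-resp : ∀ {r} {R : Carrier → Carrier → Set r} {σ} → Graph R σ → (∀ {x y} → x ≈ y → σ x ≈ σ y) →
    ∀ {x y x′ y′} → x ≈ x′ → y ≈ y′ → R x y → R x′ y′
  graph-resp R-graph σ-cong x≈ y≈ r =
    proj₂ R-graph (≈-trans (≈-sym y≈) (≈-trans (proj₁ R-graph r) (σ-cong x≈)))

  left-difference : ∀ g → Graph (λ x y → x ⁻¹ ∙ y ≈ g) (_∙ g)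
  left-difference g {x} {y} =
      (λ eq → ≈-trans (≈-sym (\\-leftDividesˡ x y)) (∙-congˡ eq))
    , (λ eq → ≈-trans (∙-congˡ eq) (\\-leftDividesʳ x g))

  right-difference : ∀ g → Graph (λ x y → x ∙ y ⁻¹ ≈ g) (λ x → g ⁻¹ ∙ x)
  right-difference g {x} {y} =
      (λ eq → y≈x\\z g y x (≈-trans (∙-congʳ (≈-sym eq)) (//-rightDividesˡ y x)))
    , (λ eq → ≈-sym (x≈z//y g y x (≈-trans (∙-congˡ eq) (\\-leftDividesˡ g x))))

  equality : Graph _≈_ (λ x → x)
  equality = ≈-sym , ≈-sym

  ⁻¹-≉ε : ∀ {g} → ¬ (g ≈ ε) → ¬ (g ⁻¹ ≈ ε)
  ⁻¹-≉ε g≉ε eq = g≉ε (≈-trans (≈-sym (⁻¹-involutive _)) (≈-trans (⁻¹-cong eq) ε⁻¹≈ε))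

  -- The hypothesis counts pairs with `x ∙ y ⁻¹ ≈ g`, that is `y ≈ g ⁻¹ ∙ x`, and thus gives the
  -- correlation at `g ⁻¹`.
  corrˡ⁻¹-value : ∀ g → ¬ (g ≈ ε) → corrˡ (g ⁻¹) ≡ ν - 1ℤ
  corrˡ⁻¹-value g g≉ε = begin
    (∑[ x ] d x · d (g ⁻¹ ∙ x))
      ≡⟨ sumOver-cong order (λ x → sumOver-point order (g ⁻¹ ∙ x) (cong (d x ·_) ∘ d-resp)
           (λ y → δ-indicator order y (g ⁻¹ ∙ x))) ⟨
    (∑[ x ] ∑[ y ] δ order y (g ⁻¹ ∙ x) · (d x · d y))
      ≡⟨ ∑-∑-cong (λ x y → rotate (δ order y (g ⁻¹ ∙ x)) (d x) (d y)) ⟩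
    (∑[ x ] ∑[ y ] d x · (d y · δ order y (g ⁻¹ ∙ x)))
      ≡⟨ sumOver-× order order (λ (x , y) → d x · (d y · δ order y (g ⁻¹ ∙ x))) ⟨
    sumOver order² (λ (x , y) → d x · (d y · δ order y (g ⁻¹ ∙ x)))
      ≡⟨ cardinality⁻¹ order²
           (λ { (x≈ , y≈) (x∈ , y∈ , eq) → respects x≈ x∈ , respects y≈ y∈ ,
             ≈-trans (∙-cong (≈-sym x≈) (⁻¹-cong (≈-sym y≈))) eq })
           (λ (x , y) → d-ind x ×ᴵ d-ind y ×ᴵ graph-indicator {R = λ x y → x ∙ y ⁻¹ ≈ g} (right-difference g) x y)
           (differences g g≉ε) ⟨
    + (n ∸ 1)
      ≡⟨ pos-n∸1 ⟩
    ν - 1ℤ ∎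
    where
    open ≡-Reasoning
    rotate : ∀ t a b → t · (a · b) ≡ a · (b · t)
    rotate = solve-∀

  corrˡ-value : ∀ g → ¬ (g ≈ ε) → corrˡ g ≡ ν - 1ℤ
  corrˡ-value g g≉ε = trans (corrˡ-resp (≈-sym (⁻¹-involutive g))) (corrˡ⁻¹-value (g ⁻¹) (⁻¹-≉ε g≉ε))

  -- This passes from quotients `x ∙ y ⁻¹`, as in the hypothesis, to quotients `x ⁻¹ ∙ y`, as in the
  -- first condition.
  corrʳ-value : ∀ g → ¬ (g ≈ ε) → corrʳ g ≡ ν - 1ℤ
  corrʳ-value g g≉ε = trans (corrʳ≡corrˡ corrˡ-value g) (corrˡ-value g g≉ε)

  squareUnion-resp : squareUnion G D Respects (Setoid._≈_ G²)
  squareUnion-resp (x≈ , y≈) (inj₁ (x∈ , y∈)) = inj₁ (respects x≈ x∈ , respects y≈ y∈)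
  squareUnion-resp (x≈ , y≈) (inj₂ ((x∉ , y∉) , off)) = inj₂
    ( (x∉ ∘ respects (≈-sym x≈) , y∉ ∘ respects (≈-sym y≈))
    , λ (_ , x≈y) → off (x∉ , ≈-trans x≈ (≈-trans x≈y (≈-sym y≈))) )

  K Lam : ℕ
  K = (4 * n ∸ 1) * (2 * n ∸ 1)
  Lam = (4 * n ∸ 1) * (n ∸ 1)

  -- Here `v - k = 2ν`, and (2ν - 1)² + 2ν(2ν - 1) = (4ν - 1)(2ν - 1).
  ∑-χ-value : (∑[ x ] ∑[ y ] χ x y) ≡ + K
  ∑-χ-value = trans ∑-χ
    (trans (arithmetic ν (pos-*∸1 4) k-value (pos-*∸1 2)) (sym (ℤ.pos-* (4 * n ∸ 1) (2 * n ∸ 1))))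
    where
    polynomial : ∀ ν → let v = + 4 · ν - 1ℤ ; k = + 2 · ν - 1ℤ in
      k · k + ((v - k) · (v - k) - (v - k)) ≡ v · k
    polynomial = solve-∀
    -- With the parameters as variables, matching on `refl` substitutes their values and leaves a
    -- polynomial identity in `ν`.
    arithmetic : ∀ ν {v k l} → v ≡ + 4 · ν - 1ℤ → k ≡ + 2 · ν - 1ℤ → l ≡ + 2 · ν - 1ℤ →
      k · k + ((v - k) · (v - k) - (v - k)) ≡ v · l
    arithmetic ν refl refl refl = polynomial ν

  -- The class sizes are ν - 1, ν, ν, ν, and (ν - 1)² + 3ν(ν - 1) = (4ν - 1)(ν - 1).
  ∑-diagonal-shift-value : ∀ g → ¬ (g ≈ ε) → (∑[ x ] ∑[ y ] χ x y · χ (x ∙ g) (y ∙ g)) ≡ + Lam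
  ∑-diagonal-shift-value g g≉ε = trans (∑-diagonal-shift g)
    (trans (arithmetic ν (pos-*∸1 4) k-value (corrʳ-value g g≉ε) pos-n∸1) (sym (ℤ.pos-* (4 * n ∸ 1) (n ∸ 1))))
    where
    polynomial : ∀ ν → let v = + 4 · ν - 1ℤ ; k = + 2 · ν - 1ℤ ; a = ν - 1ℤ ; b = k - a ; e = (v - k) - b in
      (a · a + b · b + (b · b + e · e)) - (b + b + e) ≡ v · a
    polynomial = solve-∀
    arithmetic : ∀ ν {v k a l} → v ≡ + 4 · ν - 1ℤ → k ≡ + 2 · ν - 1ℤ → a ≡ ν - 1ℤ → l ≡ ν - 1ℤ →
      let b = k - a ; e = (v - k) - b in (a · a + b · b + (b · b + e · e)) - (b + b + e) ≡ v · l
    arithmetic ν refl refl refl refl = polynomial ν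

  -- With `a = ν − 1` and `e = ν`, the count is (ν - 1)(2ν - 1) + ν(2ν - 2) = (4ν - 1)(ν - 1).
  ∑-left-shift-value : ∀ g → ¬ (g ≈ ε) → (∑[ x ] ∑[ y ] χ x y · χ (g ∙ x) y) ≡ + Lam
  ∑-left-shift-value g g≉ε = trans (∑-left-shift g g≉ε)
    (trans (arithmetic ν (pos-*∸1 4) k-value (corrˡ-value g g≉ε) pos-n∸1) (sym (ℤ.pos-* (4 * n ∸ 1) (n ∸ 1))))
    where
    polynomial : ∀ ν → let v = + 4 · ν - 1ℤ ; k = + 2 · ν - 1ℤ ; a = ν - 1ℤ ; e = (v - k) - (k - a) in
      a · k + (e · (v - k) - e - e) ≡ v · a
    polynomial = solve-∀
    arithmetic : ∀ ν {v k a l} → v ≡ + 4 · ν - 1ℤ → k ≡ + 2 · ν - 1ℤ → a ≡ ν - 1ℤ → l ≡ ν - 1ℤ →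
      let e = (v - k) - (k - a) in a · k + (e · (v - k) - e - e) ≡ v · l
    arithmetic ν refl refl refl refl = polynomial ν

  -- Given `(x , y)`, the two graphs leave `(σ x , τ y)` as the only candidate for the second pair,
  -- so the fourfold sum collapses to a double one.
  pairs-cardinality : ∀ {r s m} {R : Carrier → Carrier → Set r} {S : Carrier → Carrier → Set s}
    (σ τ : Carrier → Carrier) →
    Graph R σ → (∀ {x y} → x ≈ y → σ x ≈ σ y) → Graph S τ → (∀ {x y} → x ≈ y → τ x ≈ τ y) →
    (∑[ x ] ∑[ y ] χ x y · χ (σ x) (τ y)) ≡ + m →
    HasCardinality (Subsetoid (G² ×ₛ G²) λ ((x , y) , (x′ , y′)) →
      (x , y) ∈ squareUnion G D × (x′ , y′) ∈ squareUnion G D × R x x′ × S y y′) m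
  pairs-cardinality {m = m} {R} {S} σ τ R-graph σ-cong S-graph τ-cong count = cardinality (order² ×ᶜ order²)
    (λ { ((x≈ , y≈) , (x′≈ , y′≈)) (z∈ , z′∈ , r , s) →
      squareUnion-resp (x≈ , y≈) z∈ , squareUnion-resp (x′≈ , y′≈) z′∈ ,
      graph-resp {R = R} R-graph σ-cong x≈ x′≈ r , graph-resp {R = S} S-graph τ-cong y≈ y′≈ s })
    (λ ((x , y) , (x′ , y′)) →
      χ-indicator (x , y) ×ᴵ χ-indicator (x′ , y′) ×ᴵ
      graph-indicator {R = R} R-graph x x′ ×ᴵ graph-indicator {R = S} S-graph y y′)
    (begin
      + m
        ≡⟨ count ⟨
      (∑[ x ] ∑[ y ] χ x y · χ (σ x) (τ y))
        ≡⟨ sumOver-× order order (λ (x , y) → χ x y · χ (σ x) (τ y)) ⟨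
      sumOver order² (λ (x , y) → χ x y · χ (σ x) (τ y))
        ≡⟨ sumOver-cong order² (λ (x , y) → sumOver-point-× order (χ x y) χ χ-resp
             (λ x′ → δ-indicator order x′ (σ x)) (λ y′ → δ-indicator order y′ (τ y))) ⟨
      sumOver order² (λ z → sumOver order² λ z′ → weight (z , z′))
        ≡⟨ sumOver-× order² order² weight ⟨
      sumOver (order² ×ᶜ order²) weight ∎)
    where
    open ≡-Reasoning
    weight : (Carrier × Carrier) × (Carrier × Carrier) → ℤ
    weight ((x , y) , (x′ , y′)) = χ x y · (χ x′ y′ · (δ order x′ (σ x) · δ order y′ (τ y)))

  squareUnion-isDifferenceSetOfPropriety3 :
    IsDifferenceSetOfPropriety3 G (4 * n ∸ 1) K Lam (squareUnion G D)
  squareUnion-isDifferenceSetOfPropriety3 = record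
    { order = order
    ; respects = squareUnion-resp
    ; size = cardinality order² squareUnion-resp χ-indicator
        (trans (sym ∑-χ-value) (sym (sumOver-× order order (λ (x , y) → χ x y))))
    ; differences₁ = λ g g≉ε → pairs-cardinality (_∙ g) (_∙ g)
        (left-difference g) ∙-congʳ (left-difference g) ∙-congʳ (∑-diagonal-shift-value g g≉ε)
    ; differences₂ = λ g g≉ε → pairs-cardinality (g ⁻¹ ∙_) (λ y → y)
        (right-difference g) ∙-congˡ equality (λ eq → eq) (∑-left-shift-value (g ⁻¹) (⁻¹-≉ε g≉ε))
    ; differences₃ = λ g g≉ε → pairs-cardinality (λ x → x) (g ⁻¹ ∙_)
        equality (λ eq → eq) (right-difference g) ∙-congˡ
        -- Exchanging the two coordinates, under which `χ` is symmetric, reduces the third condition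
        -- to the second.
        (trans (sumOver-comm order order (λ x y → χ x y · χ x (g ⁻¹ ∙ y)))
          (trans (∑-∑-cong (λ y x → cong₂ _·_ (χ-sym x y) (χ-sym x (g ⁻¹ ∙ y))))
            (∑-left-shift-value (g ⁻¹) (⁻¹-≉ε g≉ε))))
    }

theorem3p13 : ∀ {c ℓ p : Level} (n : ℕ) → 2 ≤ n →
    (G : Group c ℓ) (D : Pred (Group.Carrier G) p) →
    IsDifferenceSet G (4 * n ∸ 1) (2 * n ∸ 1) (n ∸ 1) D →
    IsDifferenceSetOfPropriety3 G
    (4 * n ∸ 1) ((4 * n ∸ 1) * (2 * n ∸ 1)) ((4 * n ∸ 1) * (n ∸ 1))
    (squareUnion G D)
theorem3p13 n 2≤n G D paley = squareUnion-isDifferenceSetOfPropriety3 (ℕ.<⇒≤ 2≤n) paley
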